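{- Let $n\ge 2$ be an integer with square-free part $n_0$, and let $L_{Q(n)}$ and $L_{Q(n_0)}$ be the symmetric matrices associated with the Laplacians of $\mathcal{E}_n$ and $\mathcal{E}_{n_0}$, respectively. Then $$L_{Q(n)}=\frac{n}{n_0}\,L_{Q(n_0)}.$$
   Context: Let $p_1<\dots<p_r$ be the distinct primes dividing $n$ and $n_0=p_1\cdots p_r$ (called the square-free part of $n$). The divisors of $n_0$ are ordered as $(d_1,\dots,d_{2^r})$ recursively: for $r=1$ the order is $(1,p_1)$, and for $r$ primes the first $2^{r-1}$ entries are those for the primes $p_1,\dots,p_{r-1}$, the remaining $2^{r-1}$ entries being obtained by multiplying each of these, in order, by $p_r$. In particular $d_1=1$, $d_{2^r}=n_0$. For a divisor $d$ of $n_0$, $[d]=\{a\in\{0,1,\dots,n-1\}:\gcd(a,n_0)=d\}$ (with $\gcd(0,n_0)=n_0$), and $a_i=|[d_{i+1}]|$ for $1\le i\le 2^r-1$. The generating graph $\mathcal{E}_n$ of $\mathbb{Z}_n=\{0,\dots,n-1\}$ is the simple graph on $\mathbb{Z}_n$ in which distinct $a,b$ are adjacent iff $\langle a,b\rangle=\mathbb{Z}_n$ (iff $\gcd(a,b,n)=1$). All vertices in a class $[d_i]$ have the same degree in $\mathcal{E}_n$, denoted $\deg(d_i)$. $\varphi$ is Euler's totient function. $L_{Q(n)}$ is the symmetric real $2^r\times 2^r$ matrix with diagonal $(n-\varphi(n),\deg(d_2),\dots,\deg(d_{2^r-1}),\varphi(n))$ and off-diagonal entries $-\rho_{i,j}$,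 where $\rho_{1,j}=\rho_{j,1}=\sqrt{\varphi(n)a_{j-1}}$ for $j\ge2$, and for $i\ne j$, $i,j\ge 2$, $\rho_{i,j}=\sqrt{a_{i-1}a_{j-1}}$ if $\gcd(d_i,d_j)=1$ and $\rho_{i,j}=0$ otherwise. $L_{Q(n_0)}$ is the same construction with $n_0$ in place of $n$ (same ordering of divisors, classes and degrees taken in $\mathbb{Z}_{n_0}$ and $\mathcal{E}_{n_0}$). -}

module Defs where

open import Data.Fin.Base using (Fin; toℕ)
import Data.Fin.Base as Fin
import Data.Fin.Properties as Fin
open import Data.Integer.Base as ℤ using (+_)
import Data.Integer.Properties as ℤ
import Data.Integer.Tactic.RingSolver as ℤ-Solver
open import Data.List.Base using (List; []; _∷_; length; filter; downFrom; allFin)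
open import Data.List.Membership.Propositional.Properties using (∈-filter⁺; ∈-filter⁻; ∈-downFrom⁺)
open import Data.List.Properties using (filter-reject; filter-≐)
open import Data.List.Relation.Unary.All as All using (All)
import Data.List.Relation.Unary.All.Properties as All
open import Data.Nat.Base as ℕ
  using (ℕ; zero; suc; _+_; _*_; _∸_; _^_; _≤_; _<_; s≤s; NonZero)
open import Data.Nat.Coprimality using (coprime?)
open import Data.Nat.Divisibility
open import Data.Nat.DivMod using (_%_; _mod_; %-distribˡ-+; m<n⇒m%n≡m; [m+kn]%n≡m%n)
open import Data.Nat.GCD
open import Data.Nat.ListAction using (product)
open import Data.Nat.ListAction.Properties using (∈⇒∣product)
open import Data.Nat.Primality
open import Data.Nat.Primality.Factorisation using (factorisationHasAllPrimeFactors)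
import Data.Nat.Properties as ℕ
import Data.Nat.Tactic.RingSolver as ℕ-Solver
open import Data.Product using (∃-syntax; _×_; _,_; proj₁; proj₂)
open import Data.Rational.Unnormalised.Base as ℚ using (ℚᵘ; mkℚᵘ; 0ℚᵘ; 1ℚᵘ; _≃_; *≤*; *≡*)
import Data.Rational.Unnormalised.Properties as ℚ
import Data.Rational.Unnormalised.Solver as ℚ-Solver
open import Data.Sum.Base using (inj₁; inj₂)
open import Data.Vec.Base using (Vec; []; _∷_; _++_; map; lookup)
open import Relation.Binary.PropositionalEquality
open import Relation.Nullary using (Dec; yes; no; ¬?)
open import Relation.Nullary.Decidable using (_×-dec_; map′)
open import Relation.Unary using (Pred; Decidable; _≐_)

private
  abs≤ : ∀ {p ε} → p ℚ.≤ ε → ℚ.- p ℚ.≤ ε → ℚ.∣ p ∣ ℚ.≤ ε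
  abs≤ {p} p≤ε -p≤ε with ℚ.∣p∣≡p∨∣p∣≡-p p
  ... | inj₁ eq = subst (ℚ._≤ _) (sym eq) p≤ε
  ... | inj₂ eq = subst (ℚ._≤ _) (sym eq) -p≤ε

  p-p≤ε : ∀ p ε .{{_ : ℚ.Positive ε}} → ℚ.∣ p ℚ.- p ∣ ℚ.≤ ε
  p-p≤ε p ε = ℚ.≤-trans (ℚ.≤-reflexive (ℚ.∣-∣-cong (ℚ.+-inverseʳ p)))
                        (ℚ.<⇒≤ (ℚ.positive⁻¹ ε))

record ℝ : Set where
  constructor mkℝ
  field
    seq    : ℕ → ℚᵘ
    cauchy : ∀ ε .{{_ : ℚ.Positive ε}} →
             ∃[ N ] ∀ j k → N ≤ j → N ≤ k → ℚ.∣ seq j ℚ.- seq k ∣ ℚ.≤ ε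

open ℝ public

infix 4 _≈_

_≈_ : ℝ → ℝ → Set
x ≈ y = ∀ ε .{{_ : ℚ.Positive ε}} →
        ∃[ N ] ∀ k → N ≤ k → ℚ.∣ seq x k ℚ.- seq y k ∣ ℚ.≤ ε

fromℚ : ℚᵘ → ℝ
fromℚ q = mkℝ (λ _ → q) (λ ε → 0 , λ _ _ _ _ → p-p≤ε q ε)

fromℕ : ℕ → ℝ
fromℕ m = fromℚ (+ m ℚ./ 1)

infix 8 -_

-_ : ℝ → ℝ
seq (- x) k = ℚ.- seq x k
cauchy (- x) ε with N , h ← cauchy x ε = N , λ j k N≤j N≤k →
  ℚ.≤-trans (ℚ.≤-reflexive (ℚ.≃-trans (ℚ.∣-∣-cong (neg-diff (seq x j) (seq x k)))
                                      (ℚ.∣-p∣≃∣p∣ (seq x j ℚ.- seq x k))))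
            (h j k N≤j N≤k)
  where
  neg-diff : ∀ p q → ℚ.- p ℚ.- ℚ.- q ≃ ℚ.- (p ℚ.- q)
  neg-diff p q = ℚ.≃-reflexive (sym (ℚ.neg-distrib-+ p (ℚ.- q)))

private
  eventually-bounded : ∀ x → ∃[ B ] ∃[ N ] ℚ.Positive B × (∀ k → N ≤ k → ℚ.∣ seq x k ∣ ℚ.≤ B)
  eventually-bounded x with N , h ← cauchy x 1ℚᵘ =
    1ℚᵘ ℚ.+ ℚ.∣ seq x N ∣ , N ,
    ℚ.positive (ℚ.<-≤-trans (ℚ.positive⁻¹ 1ℚᵘ)
                            (ℚ.p≤p+q 1ℚᵘ ℚ.∣ seq x N ∣ {{ℚ.∣-∣-nonNeg (seq x N)}})) ,
    λ k N≤k → begin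
      ℚ.∣ seq x k ∣                                  ≃⟨ ℚ.∣-∣-cong (split (seq x k) (seq x N)) ⟩
      ℚ.∣ (seq x k ℚ.- seq x N) ℚ.+ seq x N ∣        ≤⟨ ℚ.∣p+q∣≤∣p∣+∣q∣ (seq x k ℚ.- seq x N) (seq x N) ⟩
      ℚ.∣ seq x k ℚ.- seq x N ∣ ℚ.+ ℚ.∣ seq x N ∣    ≤⟨ ℚ.+-monoˡ-≤ ℚ.∣ seq x N ∣ (h k N N≤k ℕ.≤-refl) ⟩
      1ℚᵘ ℚ.+ ℚ.∣ seq x N ∣                          ∎
    where
    open ℚ.≤-Reasoning
    open ℚ-Solver.+-*-Solver
    split : ∀ p q → p ≃ (p ℚ.- q) ℚ.+ q
    split = solve 2 (λ p q → p := (p :- q) :+ q) ℚ.≃-refl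

infixl 7 _·_

_·_ : ℝ → ℝ → ℝ
seq (x · y) k = seq x k ℚ.* seq y k
cauchy (x · y) ε
  with B , N₁ , B>0 , x≤B ← eventually-bounded x
     | C , N₂ , C>0 , y≤C ← eventually-bounded y = go
  where
  B+C>0 : ℚ.Positive (B ℚ.+ C)
  B+C>0 = ℚ.pos+pos⇒pos B {{B>0}} C {{C>0}}

  instance
    _ = B+C>0
    B+C≢0 : ℚ.NonZero (B ℚ.+ C)
    B+C≢0 = ℚ.pos⇒nonZero (B ℚ.+ C)

  δ : ℚᵘ
  δ = ε ℚ.* ℚ.1/ (B ℚ.+ C)

  instance
    1/>0 : ℚ.Positive (ℚ.1/ (B ℚ.+ C))
    1/>0 = ℚ.1/pos⇒pos (B ℚ.+ C)
    δ>0 : ℚ.Positive δ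
    δ>0 = ℚ.pos*pos⇒pos ε (ℚ.1/ (B ℚ.+ C))

  mult-diff : ∀ a b c d → a ℚ.* b ℚ.- c ℚ.* d ≃ a ℚ.* (b ℚ.- d) ℚ.+ d ℚ.* (a ℚ.- c)
  mult-diff = solve 4 (λ a b c d → a :* b :- c :* d := a :* (b :- d) :+ d :* (a :- c)) ℚ.≃-refl
    where open ℚ-Solver.+-*-Solver

  factor : ∀ b c e i → b ℚ.* (e ℚ.* i) ℚ.+ c ℚ.* (e ℚ.* i) ≃ e ℚ.* ((b ℚ.+ c) ℚ.* i)
  factor = solve 4 (λ b c e i → b :* (e :* i) :+ c :* (e :* i) := e :* ((b :+ c) :* i)) ℚ.≃-refl
    where open ℚ-Solver.+-*-Solver

  ∣*∣≤ : ∀ p q {b e} → ℚ.∣ p ∣ ℚ.≤ b → ℚ.∣ q ∣ ℚ.≤ e → ℚ.∣ p ℚ.* q ∣ ℚ.≤ b ℚ.* e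
  ∣*∣≤ p q p≤b q≤e = ℚ.≤-trans (ℚ.≤-reflexive (ℚ.∣p*q∣≃∣p∣*∣q∣ p q))
    (ℚ.*-mono-≤-nonNeg {{ℚ.∣-∣-nonNeg p}} {{ℚ.∣-∣-nonNeg q}} p≤b q≤e)

  go : ∃[ N ] ∀ j k → N ≤ j → N ≤ k → ℚ.∣ seq (x · y) j ℚ.- seq (x · y) k ∣ ℚ.≤ ε
  go with N₃ , hx ← cauchy x δ | N₄ , hy ← cauchy y δ =
    N₁ + N₂ + (N₃ + N₄) , λ j k N≤j N≤k →
    let xj = seq x j ; xk = seq x k ; yj = seq y j ; yk = seq y k
        ₁≤ = ℕ.≤-trans (ℕ.m≤m+n N₁ N₂) (ℕ.m≤m+n (N₁ + N₂) (N₃ + N₄))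
        ₂≤ = ℕ.≤-trans (ℕ.m≤n+m N₂ N₁) (ℕ.m≤m+n (N₁ + N₂) (N₃ + N₄))
        ₃≤ = ℕ.≤-trans (ℕ.m≤m+n N₃ N₄) (ℕ.m≤n+m (N₃ + N₄) (N₁ + N₂))
        ₄≤ = ℕ.≤-trans (ℕ.m≤n+m N₄ N₃) (ℕ.m≤n+m (N₃ + N₄) (N₁ + N₂))
    in begin
      ℚ.∣ xj ℚ.* yj ℚ.- xk ℚ.* yk ∣
        ≃⟨ ℚ.∣-∣-cong (mult-diff xj yj xk yk) ⟩
      ℚ.∣ xj ℚ.* (yj ℚ.- yk) ℚ.+ yk ℚ.* (xj ℚ.- xk) ∣
        ≤⟨ ℚ.∣p+q∣≤∣p∣+∣q∣ (xj ℚ.* (yj ℚ.- yk)) (yk ℚ.* (xj ℚ.- xk)) ⟩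
      ℚ.∣ xj ℚ.* (yj ℚ.- yk) ∣ ℚ.+ ℚ.∣ yk ℚ.* (xj ℚ.- xk) ∣
        ≤⟨ ℚ.+-mono-≤
             (∣*∣≤ xj (yj ℚ.- yk) (x≤B j (ℕ.≤-trans ₁≤ N≤j))
                   (hy j k (ℕ.≤-trans ₄≤ N≤j) (ℕ.≤-trans ₄≤ N≤k)))
             (∣*∣≤ yk (xj ℚ.- xk) (y≤C k (ℕ.≤-trans ₂≤ N≤k))
                   (hx j k (ℕ.≤-trans ₃≤ N≤j) (ℕ.≤-trans ₃≤ N≤k))) ⟩
      B ℚ.* δ ℚ.+ C ℚ.* δ
        ≃⟨ factor B C ε (ℚ.1/ (B ℚ.+ C)) ⟩
      ε ℚ.* ((B ℚ.+ C) ℚ.* ℚ.1/ (B ℚ.+ C))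
        ≃⟨ ℚ.*-congˡ {ε} (ℚ.*-inverseʳ (B ℚ.+ C)) ⟩
      ε ℚ.* 1ℚᵘ
        ≃⟨ ℚ.*-identityʳ ε ⟩
      ε ∎
    where open ℚ.≤-Reasoning

⌊√_⌋ : ℕ → ℕ
⌊√ zero ⌋  = 0
⌊√ suc m ⌋ with suc ⌊√ m ⌋ * suc ⌊√ m ⌋ ℕ.≤? suc m
... | yes _ = suc ⌊√ m ⌋
... | no  _ = ⌊√ m ⌋

⌊√⌋-lower : ∀ m → ⌊√ m ⌋ * ⌊√ m ⌋ ≤ m
⌊√⌋-lower zero = ℕ.z≤n
⌊√⌋-lower (suc m) with suc ⌊√ m ⌋ * suc ⌊√ m ⌋ ℕ.≤? suc m
... | yes s≤ = s≤
... | no  _  = ℕ.m≤n⇒m≤1+n (⌊√⌋-lower m)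

⌊√⌋-upper : ∀ m → m < suc ⌊√ m ⌋ * suc ⌊√ m ⌋
⌊√⌋-upper zero = s≤s ℕ.z≤n
⌊√⌋-upper (suc m) with suc ⌊√ m ⌋ * suc ⌊√ m ⌋ ℕ.≤? suc m
... | yes _  = ℕ.≤-<-trans (⌊√⌋-upper m) (ℕ.*-mono-< s<s′ s<s′)
  where
  s<s′ : suc ⌊√ m ⌋ < suc (suc ⌊√ m ⌋)
  s<s′ = ℕ.n<1+n (suc ⌊√ m ⌋)
... | no  s≰ = ℕ.≰⇒> s≰

-- The k-th approximation of √ m is ⌊√ (m (k+1)²)⌋ / (k+1), which is at most √ m
-- and within 1/(k+1) of it.
√-num : ℕ → ℕ → ℕ
√-num m k = ⌊√ m * (suc k * suc k) ⌋

√-approx : ℕ → ℕ → ℚᵘ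
√-approx m k = mkℚᵘ (+ √-num m k) k

private
  square-cancel-< : ∀ a b → a * a < b * b → a < b
  square-cancel-< a b a²<b² = ℕ.≰⇒> λ b≤a → ℕ.<⇒≱ a²<b² (ℕ.*-mono-≤ b≤a b≤a)

  square-cancel-≤ : ∀ a b → a * a ≤ b * b → a ≤ b
  square-cancel-≤ a b a²≤b² = ℕ.≮⇒≥ λ b<a → ℕ.≤⇒≯ a²≤b² (ℕ.*-mono-< b<a b<a)

  √-num-cross : ∀ m j k → √-num m j * suc k < suc (√-num m k) * suc j
  √-num-cross m j k =
    square-cancel-< _ _ (cross (√-num m j) (suc (√-num m k)) (suc j) (suc k)
      (⌊√⌋-lower (m * (suc j * suc j))) (⌊√⌋-upper (m * (suc k * suc k))))
    where
    open ℕ.≤-Reasoning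
    cross : ∀ a b u v .{{_ : NonZero u}} →
            a * a ≤ m * (u * u) → m * (v * v) < b * b → (a * v) * (a * v) < (b * u) * (b * u)
    cross a b u@(suc _) v a²≤ <b² = begin-strict
      (a * v) * (a * v)        ≡⟨ ℕ.[m*n]*[o*p]≡[m*o]*[n*p] a v a v ⟩
      (a * a) * (v * v)        ≤⟨ ℕ.*-monoˡ-≤ (v * v) a²≤ ⟩
      m * (u * u) * (v * v)    ≡⟨ ℕ.*-assoc m (u * u) (v * v) ⟩
      m * (u * u * (v * v))    ≡⟨ cong (m *_) (ℕ.*-comm (u * u) (v * v)) ⟩
      m * (v * v * (u * u))    ≡⟨ ℕ.*-assoc m (v * v) (u * u) ⟨
      m * (v * v) * (u * u)    <⟨ ℕ.*-monoˡ-< (u * u) <b² ⟩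
      (b * b) * (u * u)        ≡⟨ ℕ.[m*n]*[o*p]≡[m*o]*[n*p] b b u u ⟩
      (b * u) * (b * u)        ∎

  1/suc≤ : ∀ p q k → q ≤ k → mkℚᵘ (+ 1) k ℚ.≤ mkℚᵘ (+ suc p) q
  1/suc≤ p q k q≤k = *≤* (ℤ.+≤+ (begin
    1 * suc q        ≡⟨ ℕ.*-identityˡ (suc q) ⟩
    suc q            ≤⟨ s≤s q≤k ⟩
    suc k            ≤⟨ ℕ.m≤m+n (suc k) (p * suc k) ⟩
    suc p * suc k    ∎))
    where open ℕ.≤-Reasoning

  √-approx-diff : ∀ m j k → √-approx m j ℚ.- √-approx m k ℚ.≤ mkℚᵘ (+ 1) k
  √-approx-diff m j k = begin
    x ℚ.- y                            ≤⟨ ℚ.+-monoˡ-≤ (ℚ.- y) x≤ ⟩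
    mkℚᵘ (+ suc b) k ℚ.- y             ≃⟨ ℚ.+-congˡ {mkℚᵘ (+ suc b) k} {mkℚᵘ (+ 1) k ℚ.+ y} (ℚ.- y) (*≡* (suc-frac (+ b) (+ suc k))) ⟩
    (mkℚᵘ (+ 1) k ℚ.+ y) ℚ.- y         ≃⟨ cancel (mkℚᵘ (+ 1) k) y ⟩
    mkℚᵘ (+ 1) k                       ∎
    where
    open ℚ.≤-Reasoning
    b = √-num m k
    x = √-approx m j
    y = √-approx m k
    x≤ : x ℚ.≤ mkℚᵘ (+ suc b) k
    x≤ = *≤* (subst₂ ℤ._≤_ (ℤ.pos-* (√-num m j) (suc k)) (ℤ.pos-* (suc b) (suc j))
                     (ℤ.+≤+ (ℕ.<⇒≤ (√-num-cross m j k))))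
    suc-frac : ∀ B K → (+ 1 ℤ.+ B) ℤ.* (K ℤ.* K) ≡ (+ 1 ℤ.* K ℤ.+ B ℤ.* K) ℤ.* K
    suc-frac = ℤ-Solver.solve-∀
    cancel : ∀ p q → (p ℚ.+ q) ℚ.- q ≃ p
    cancel = solve 2 (λ p q → (p :+ q) :- q := p) ℚ.≃-refl
      where open ℚ-Solver.+-*-Solver

√_ : ℕ → ℝ
seq (√ m) = √-approx m
cauchy (√ m) ε@(mkℚᵘ (+ suc p) q) = q , λ j k q≤j q≤k → abs≤
  (ℚ.≤-trans (√-approx-diff m j k) (1/suc≤ p q k q≤k))
  (ℚ.≤-trans (ℚ.≤-reflexive (neg-sub (√-approx m j) (√-approx m k)))
             (ℚ.≤-trans (√-approx-diff m k j) (1/suc≤ p q j q≤j)))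
  where
  neg-sub : ∀ p q → ℚ.- (p ℚ.- q) ≃ q ℚ.- p
  neg-sub = solve 2 (λ p q → :- (p :- q) := q :- p) ℚ.≃-refl
    where open ℚ-Solver.+-*-Solver

√-nonNegative : ∀ m k → 0ℚᵘ ℚ.≤ seq (√ m) k
√-nonNegative m k = *≤* (subst (+ 0 ℤ.≤_) (ℤ.pos-* (√-num m k) 1) (ℤ.+≤+ ℕ.z≤n))

private
  √-num-above : ∀ m b u v P .{{_ : NonZero u}} .{{_ : NonZero P}} →
    b * b ≤ m * (u * u) → m * (u * u) < suc b * suc b → 2 * m * v ≤ u →
    m * (u * u * v) ≤ (b * b * v + P * (u * u)) * 1
  √-num-above m b u@(suc _) v P b²≤ <b² N≤ = begin
    m * (u * u * v)                   ≡⟨ ℕ.*-assoc m (u * u) v ⟨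
    m * (u * u) * v                   ≤⟨ ℕ.*-monoˡ-≤ v (ℕ.s≤s⁻¹ <b²) ⟩
    (b + b * suc b) * v               ≡⟨ expand b v ⟩
    b * b * v + b * (2 * v)           ≤⟨ ℕ.+-monoʳ-≤ (b * b * v) (ℕ.*-monoˡ-≤ (2 * v) b≤) ⟩
    b * b * v + m * u * (2 * v)       ≡⟨ cong (λ z → b * b * v + z) (regroup m u v) ⟩
    b * b * v + 2 * m * v * u         ≤⟨ ℕ.+-monoʳ-≤ (b * b * v) (ℕ.*-monoˡ-≤ u N≤) ⟩
    b * b * v + u * u                 ≤⟨ ℕ.+-monoʳ-≤ (b * b * v) (ℕ.m≤n*m (u * u) P) ⟩
    b * b * v + P * (u * u)           ≡⟨ ℕ.*-identityʳ _ ⟨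
    (b * b * v + P * (u * u)) * 1     ∎
    where
    open ℕ.≤-Reasoning
    expand : ∀ b v → (b + b * suc b) * v ≡ b * b * v + b * (2 * v)
    expand = ℕ-Solver.solve-∀
    regroup : ∀ m u v → m * u * (2 * v) ≡ 2 * m * v * u
    regroup = ℕ-Solver.solve-∀
    square-≤ : ∀ a → a ≤ a * a
    square-≤ zero      = ℕ.z≤n
    square-≤ a@(suc _) = ℕ.m≤m*n a a
    b≤ : b ≤ m * u
    b≤ = square-cancel-≤ b (m * u) (ℕ.≤-trans b²≤ (subst (m * (u * u) ≤_)
           (sym (ℕ.[m*n]*[o*p]≡[m*o]*[n*p] m u m u)) (ℕ.*-monoˡ-≤ (u * u) (square-≤ m))))

√-square : ∀ m → √ m · √ m ≈ fromℕ m
√-square m ε@(mkℚᵘ (+ suc p) q) = 2 * m * suc q , λ k N≤k → abs≤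
  (ℚ.≤-trans (ℚ.p≤q⇒p-q≤0 (below k)) (ℚ.<⇒≤ (ℚ.positive⁻¹ ε)))
  (begin
    ℚ.- (sq k ℚ.- fm)      ≃⟨ neg-sub (sq k) fm ⟩
    fm ℚ.- sq k            ≤⟨ ℚ.+-monoˡ-≤ (ℚ.- sq k) (above k N≤k) ⟩
    sq k ℚ.+ ε ℚ.- sq k    ≃⟨ cancel (sq k) ε ⟩
    ε                      ∎)
  where
  open ℚ.≤-Reasoning
  fm : ℚᵘ
  fm = + m ℚ./ 1
  sq : ℕ → ℚᵘ
  sq k = seq (√ m · √ m) k

  neg-sub : ∀ p q → ℚ.- (p ℚ.- q) ≃ q ℚ.- p
  neg-sub = solve 2 (λ p q → :- (p :- q) := q :- p) ℚ.≃-refl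
    where open ℚ-Solver.+-*-Solver
  cancel : ∀ p q → p ℚ.+ q ℚ.- p ≃ q
  cancel = solve 2 (λ p q → p :+ q :- p := q) ℚ.≃-refl
    where open ℚ-Solver.+-*-Solver

  below : ∀ k → sq k ℚ.≤ fm
  below k = *≤* (subst₂ ℤ._≤_
    (trans (ℤ.pos-* (b * b) 1) (cong (ℤ._* + 1) (ℤ.pos-* b b))) (ℤ.pos-* m _)
    (ℤ.+≤+ (subst (_≤ m * (suc k * suc k)) (sym (ℕ.*-identityʳ (b * b)))
                   (⌊√⌋-lower (m * (suc k * suc k))))))
    where b = √-num m k

  above : ∀ k → 2 * m * suc q ≤ k → fm ℚ.≤ sq k ℚ.+ ε
  above k N≤k = *≤* (subst₂ ℤ._≤_ (ℤ.pos-* m _)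
    (trans (ℤ.pos-* (b * b * suc q + suc p * (suc k * suc k)) 1)
           (cong (λ z → (z ℤ.+ (+ (suc p * (suc k * suc k)))) ℤ.* + 1)
                 (trans (ℤ.pos-* (b * b) (suc q)) (cong (ℤ._* + suc q) (ℤ.pos-* b b)))))
    (ℤ.+≤+ (√-num-above m b (suc k) (suc q) (suc p)
              (⌊√⌋-lower (m * (suc k * suc k))) (⌊√⌋-upper (m * (suc k * suc k)))
              (ℕ.m≤n⇒m≤1+n N≤k))))
    where b = √-num m k

Matrix : ℕ → Set
Matrix m = Fin m → Fin m → ℝ

infix  4 _≈ᴹ_
infixl 7 _·ᴹ_

_≈ᴹ_ : ∀ {m} → Matrix m → Matrix m → Set
A ≈ᴹ B = ∀ i j → A i j ≈ B i j

_·ᴹ_ : ∀ {m} → ℚᵘ → Matrix m → Matrix m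
(c ·ᴹ A) i j = fromℚ c · A i j

castᴹ : ∀ {m k} → .(m ≡ k) → Matrix m → Matrix k
castᴹ eq A i j = A (Fin.cast (sym eq) i) (Fin.cast (sym eq) j)

isPrimeDivisor? : ∀ n → Decidable (λ p → Prime p × p ∣ n)
isPrimeDivisor? n p = prime? p ×-dec p ∣? n

-- p_r , … , p_1: in decreasing order, so that the head is the largest prime.
primeDivisors : ℕ → List ℕ
primeDivisors n = filter (isPrimeDivisor? n) (downFrom (suc n))

ω : ℕ → ℕ
ω n = length (primeDivisors n)

squarefreePart : ℕ → ℕ
squarefreePart n = product (primeDivisors n)

private
  primeDivisors-prime : ∀ n → All Prime (primeDivisors n)
  primeDivisors-prime n = All.map proj₁ (All.all-filter (isPrimeDivisor? n) (downFrom (suc n)))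

squarefreePart-nonZero : ∀ n → NonZero (squarefreePart n)
squarefreePart-nonZero n = productOfPrimes≢0 (primeDivisors-prime n)

private
  filter-downFrom : ∀ {P : ℕ → Set} (P? : Decidable P) b → (∀ {p} → P p → p < b) →
                    ∀ k → filter P? (downFrom (k + b)) ≡ filter P? (downFrom b)
  filter-downFrom P? b bound zero    = refl
  filter-downFrom P? b bound (suc k) = trans
    (filter-reject P? {k + b} {downFrom (k + b)} (λ Pk+b → ℕ.<⇒≱ (bound Pk+b) (ℕ.m≤n+m b k)))
    (filter-downFrom P? b bound k)

  ∣squarefreePart⁺ : ∀ n .{{_ : NonZero n}} {p} → Prime p → p ∣ n → p ∣ squarefreePart n
  ∣squarefreePart⁺ n pr p∣n = ∈⇒∣product
    (∈-filter⁺ (isPrimeDivisor? n) (∈-downFrom⁺ (s≤s (∣⇒≤ p∣n))) (pr , p∣n))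

  ∣squarefreePart⁻ : ∀ n {p} → Prime p → p ∣ squarefreePart n → p ∣ n
  ∣squarefreePart⁻ n pr p∣n₀ = proj₂ (proj₂ (∈-filter⁻ (isPrimeDivisor? n) {xs = downFrom (suc n)}
    (factorisationHasAllPrimeFactors pr p∣n₀ (primeDivisors-prime n))))

primeDivisors-squarefreePart : ∀ n .{{_ : NonZero n}} →
                               primeDivisors (squarefreePart n) ≡ primeDivisors n
primeDivisors-squarefreePart n = begin
  filter P₀? (downFrom (suc n₀))             ≡⟨ filter-downFrom P₀? (suc n₀) (λ (_ , p∣n₀) → s≤s (∣⇒≤ p∣n₀)) (suc n) ⟨
  filter P₀? (downFrom (suc n + suc n₀))     ≡⟨ filter-≐ P₀? P? P₀≐P (downFrom (suc n + suc n₀)) ⟩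
  filter P? (downFrom (suc n + suc n₀))      ≡⟨ cong (λ b → filter P? (downFrom b)) (ℕ.+-comm (suc n) (suc n₀)) ⟩
  filter P? (downFrom (suc n₀ + suc n))      ≡⟨ filter-downFrom P? (suc n) (λ (_ , p∣n) → s≤s (∣⇒≤ p∣n)) (suc n₀) ⟩
  filter P? (downFrom (suc n))               ∎
  where
  open ≡-Reasoning
  n₀ = squarefreePart n
  instance _ = squarefreePart-nonZero n
  P? = isPrimeDivisor? n
  P₀? = isPrimeDivisor? n₀
  P₀≐P : (λ p → Prime p × p ∣ n₀) ≐ (λ p → Prime p × p ∣ n)
  P₀≐P = (λ (pr , p∣n₀) → pr , ∣squarefreePart⁻ n pr p∣n₀) ,
         (λ (pr , p∣n) → pr , ∣squarefreePart⁺ n pr p∣n)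

ω-squarefreePart : ∀ n .{{_ : NonZero n}} → ω (squarefreePart n) ≡ ω n
ω-squarefreePart n = cong length (primeDivisors-squarefreePart n)

-- The divisors of p_1 ⋯ p_r in the recursive order, from p_r , … , p_1.
-- The trailing [] makes the length 2 ^ suc r = 2 ^ r + (2 ^ r + 0) definitionally.
orderedDivisors : (ps : List ℕ) → Vec ℕ (2 ^ length ps)
orderedDivisors []       = 1 ∷ []
orderedDivisors (p ∷ ps) = orderedDivisors ps ++ (map (_* p) (orderedDivisors ps) ++ [])

divisor : ∀ n → Fin (2 ^ ω n) → ℕ
divisor n = lookup (orderedDivisors (primeDivisors n))

card : ∀ {n p} {P : Pred (Fin n) p} → Decidable P → ℕ
card {n} P? = length (filter P? (allFin n))

-- The coprime residues are sought among 1 , … , n.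
φ : ℕ → ℕ
φ n = card {n} (λ k → coprime? (suc (toℕ k)) n)

infix 4 _∈[_]

_∈[_] : ∀ {n} → Fin n → ℕ → Set
_∈[_] {n} a d = gcd (toℕ a) (squarefreePart n) ≡ d

_∈[_]? : ∀ {n} (a : Fin n) d → Dec (a ∈[ d ])
_∈[_]? {n} a d = gcd (toℕ a) (squarefreePart n) ℕ.≟ d

∣class∣ : ℕ → ℕ → ℕ
∣class∣ n d = card {n} (_∈[ d ]?)

module _ {n : ℕ} .{{_ : NonZero n}} where

  infixl 6 _⊕_

  _⊕_ : Fin n → Fin n → Fin n
  x ⊕ y = (toℕ x + toℕ y) mod n

  ⊖_ : Fin n → Fin n
  ⊖ x = (n ∸ toℕ x) mod n

  data ⟨_,_⟩ (a b : Fin n) : Fin n → Set where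
    left    : ⟨ a , b ⟩ a
    right   : ⟨ a , b ⟩ b
    sum     : ∀ {x y} → ⟨ a , b ⟩ x → ⟨ a , b ⟩ y → ⟨ a , b ⟩ (x ⊕ y)
    inverse : ∀ {x} → ⟨ a , b ⟩ x → ⟨ a , b ⟩ (⊖ x)

  Generate : Fin n → Fin n → Set
  Generate a b = ∀ x → ⟨ a , b ⟩ x

  private
    toℕ-mod : ∀ m → toℕ (m mod n) ≡ m % n
    toℕ-mod m = Fin.toℕ-fromℕ< _

    mod-cong : ∀ {m k} → m % n ≡ k % n → m mod n ≡ k mod n
    mod-cong {m} {k} eq = Fin.toℕ-injective (trans (toℕ-mod m) (trans eq (sym (toℕ-mod k))))

    mod-toℕ : ∀ x → toℕ x mod n ≡ x
    mod-toℕ x = Fin.toℕ-injective (trans (toℕ-mod (toℕ x)) (m<n⇒m%n≡m (Fin.toℕ<n x)))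

    ⊕-mod : ∀ m k → (m mod n) ⊕ (k mod n) ≡ (m + k) mod n
    ⊕-mod m k = trans
      (cong₂ (λ u v → (u + v) mod n) (toℕ-mod m) (toℕ-mod k))
      (mod-cong {m % n + k % n} {m + k} (sym (%-distribˡ-+ m k n)))

  gcd₃ : Fin n → Fin n → ℕ
  gcd₃ a b = gcd (gcd (toℕ a) (toℕ b)) n

  Generate⇒gcd≡1 : ∀ a b → Generate a b → gcd₃ a b ≡ 1
  Generate⇒gcd≡1 a b gen =
    ∣1⇒≡1 (∣n∣m%n⇒∣m g∣n (subst (gcd₃ a b ∣_) (toℕ-mod 1) (g∣ (gen (1 mod n)))))
    where
    g∣n : gcd₃ a b ∣ n
    g∣n = gcd[m,n]∣n (gcd (toℕ a) (toℕ b)) n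
    g∣gcd : gcd₃ a b ∣ gcd (toℕ a) (toℕ b)
    g∣gcd = gcd[m,n]∣m (gcd (toℕ a) (toℕ b)) n
    g∣mod : ∀ m → gcd₃ a b ∣ m → gcd₃ a b ∣ toℕ (m mod n)
    g∣mod m g∣m = subst (gcd₃ a b ∣_) (sym (toℕ-mod m)) (%-presˡ-∣ g∣m g∣n)
    g∣ : ∀ {x} → ⟨ a , b ⟩ x → gcd₃ a b ∣ toℕ x
    g∣ left            = ∣-trans g∣gcd (gcd[m,n]∣m (toℕ a) (toℕ b))
    g∣ right           = ∣-trans g∣gcd (gcd[m,n]∣n (toℕ a) (toℕ b))
    g∣ (sum x∈ y∈)     = g∣mod _ (∣m∣n⇒∣m+n (g∣ x∈) (g∣ y∈))
    g∣ (inverse {x} x∈) = g∣mod (n ∸ toℕ x)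
      (∣m+n∣m⇒∣n (subst (gcd₃ a b ∣_) (sym (ℕ.m+[n∸m]≡n (ℕ.<⇒≤ (Fin.toℕ<n x)))) g∣n) (g∣ x∈))

  gcd≡1⇒Generate : ∀ a b → gcd₃ a b ≡ 1 → Generate a b
  gcd≡1⇒Generate a b g≡1 x =
    subst ⟨ a , b ⟩ (trans (cong (_mod n) (ℕ.*-identityʳ (toℕ x))) (mod-toℕ x))
          (S-* (toℕ x) S-1)
    where
    S : ℕ → Set
    S m = ⟨ a , b ⟩ (m mod n)

    S-cong : ∀ {m k} → m % n ≡ k % n → S m → S k
    S-cong {m} {k} eq = subst ⟨ a , b ⟩ (mod-cong {m} {k} eq)

    S-a : S (toℕ a)
    S-a = subst ⟨ a , b ⟩ (sym (mod-toℕ a)) left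

    S-b : S (toℕ b)
    S-b = subst ⟨ a , b ⟩ (sym (mod-toℕ b)) right

    S-+ : ∀ {m k} → S m → S k → S (m + k)
    S-+ {m} {k} Sm Sk = subst ⟨ a , b ⟩ (⊕-mod m k) (sum Sm Sk)

    S-suc* : ∀ k {m} → S m → S (suc k * m)
    S-suc* zero    {m} Sm = subst S (sym (ℕ.+-identityʳ m)) Sm
    S-suc* (suc k) {m} Sm = S-+ {m} {suc k * m} Sm (S-suc* k Sm)

    S-* : ∀ k {m} → S m → S (k * m)
    S-* (suc k) Sm = S-suc* k Sm
    S-* zero    Sm = S-cong {n * toℕ a} {0}
      (trans (cong (_% n) (ℕ.*-comm n (toℕ a))) ([m+kn]%n≡m%n 0 (toℕ a) n))
      (subst (λ k → S (k * toℕ a)) (ℕ.suc-pred n) (S-suc* (ℕ.pred n) S-a))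

    S-n : S n
    S-n = S-cong {0} {n} (sym (trans (cong (_% n) (sym (ℕ.*-identityˡ n))) ([m+kn]%n≡m%n 0 1 n)))
                 (S-* 0 S-a)

    S-cancel : ∀ {m k} → S (m + k) → S k → S m
    S-cancel {m} {k} Sm+k Sk = S-cong {m + k + ℕ.pred n * k} {m}
      (trans (cong (_% n) eq) ([m+kn]%n≡m%n m k n))
      (S-+ {m + k} {ℕ.pred n * k} Sm+k (S-* (ℕ.pred n) Sk))
      where
      eq : m + k + ℕ.pred n * k ≡ m + k * n
      eq = trans (ℕ.+-assoc m k (ℕ.pred n * k))
                 (cong (λ z → m + z) (trans (cong (_* k) (ℕ.suc-pred n)) (ℕ.*-comm n k)))

    S-gcd : ∀ {m k} → S m → S k → S (gcd m k)
    S-gcd {m} {k} Sm Sk with Bézout.identity (gcd-GCD m k)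
    ... | Bézout.+- x y eq = S-cancel {gcd m k} {y * k} (subst S (sym eq) (S-* x Sm)) (S-* y Sk)
    ... | Bézout.-+ x y eq = S-cancel {gcd m k} {x * m} (subst S (sym eq) (S-* y Sk)) (S-* x Sm)

    S-1 : S 1
    S-1 = subst S g≡1 (S-gcd {gcd (toℕ a) (toℕ b)} {n} (S-gcd {toℕ a} {toℕ b} S-a S-b) S-n)

  generate? : ∀ a b → Dec (Generate a b)
  generate? a b = map′ (gcd≡1⇒Generate a b) (Generate⇒gcd≡1 a b) (gcd₃ a b ℕ.≟ 1)

  Adjacent : Fin n → Fin n → Set
  Adjacent a b = a ≢ b × Generate a b

  adjacent? : ∀ a → Decidable (Adjacent a)
  adjacent? a b = ¬? (a Fin.≟ b) ×-dec generate? a b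

  degree : Fin n → ℕ
  degree a = card (adjacent? a)

module _ (n : ℕ) .{{_ : NonZero n}} where

  -- The vertices in [d] have the same degree; d itself is one of them (as the
  -- vertex 0 when d = n).
  deg : ℕ → ℕ
  deg d = degree (d mod n)

  Index : Set
  Index = Fin (2 ^ ω n)

  first? : (i : Index) → Dec (toℕ i ≡ 0)
  first? i = toℕ i ℕ.≟ 0

  last? : (i : Index) → Dec (suc (toℕ i) ≡ 2 ^ ω n)
  last? i = suc (toℕ i) ℕ.≟ 2 ^ ω n

  classSize : Index → ℕ
  classSize i = ∣class∣ n (divisor n i)

  diagonal : Index → ℕ
  diagonal i with first? i | last? i
  ... | yes _ | _     = n ∸ φ n
  ... | no _  | yes _ = φ n
  ... | no _  | no _  = deg (divisor n i)

  ρ : Index → Index → ℝ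
  ρ i j with first? i | first? j | gcd (divisor n i) (divisor n j) ℕ.≟ 1
  ... | yes _ | _     | _     = √ (φ n * classSize j)
  ... | no _  | yes _ | _     = √ (φ n * classSize i)
  ... | no _  | no _  | yes _ = √ (classSize i * classSize j)
  ... | no _  | no _  | no _  = fromℕ 0

  L_Q : Matrix (2 ^ ω n)
  L_Q i j with i Fin.≟ j
  ... | yes _ = fromℕ (diagonal i)
  ... | no _  = - ρ i j

{-# OPTIONS --safe #-}

-- Write n = c n₀. The classes, the degrees of vertices d ≠ 1 and φ all count residues
-- modulo n subject to a condition that is periodic modulo n₀, so each is c times the
-- corresponding number for n₀. (For d ≠ 1 dividing n, the neighbours of d are exactly the
-- b coprime to d, the vertex d itself being excluded automatically.) An off-diagonal entry
-- is a root √ (c a · c b) = c √ (a b).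
module Submission where

open import Defs
open import Data.Bool.Base using (true; false; if_then_else_)
open import Data.Fin.Base using (Fin; toℕ)
import Data.Fin.Base as Fin
import Data.Fin.Properties as Fin
open import Data.Integer.Base as ℤ using (+_)
import Data.Integer.Properties as ℤ
import Data.Integer.Tactic.RingSolver as ℤ-Solver
open import Data.List.Base using ([]; _∷_; length; filter; tabulate; downFrom)
open import Data.List.Membership.Propositional.Properties using (∈-filter⁺; ∈-downFrom⁺)
open import Data.List.Relation.Unary.All as All using (All; []; _∷_)
import Data.List.Relation.Unary.All.Properties as All
open import Data.List.Relation.Unary.AllPairs using ([]; _∷_)
open import Data.List.Relation.Unary.Unique.Propositional using (Unique)
import Data.List.Relation.Unary.Unique.Propositional.Properties as Unique
open import Data.Nat.Base as ℕ using (ℕ; zero; suc; _+_; _*_; _∸_; _^_; _≤_; s≤s; NonZero)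
open import Data.Nat.Coprimality as Coprime using (Coprime; coprime?)
open import Data.Nat.Divisibility
open import Data.Nat.DivMod using (_%_; _mod_)
open import Data.Nat.GCD
open import Data.Nat.ListAction using (product)
open import Data.Nat.ListAction.Properties using (∈⇒∣product)
open import Data.Nat.Primality
open import Data.Nat.Primality.Factorisation
import Data.Nat.Properties as ℕ
open import Data.Product using (∃-syntax; _×_; _,_; proj₁; proj₂)
open import Data.Rational.Unnormalised.Base as ℚ using (mkℚᵘ; _≃_; *≤*; *≡*; _/_)
import Data.Rational.Unnormalised.Properties as ℚ
import Data.Rational.Unnormalised.Solver as ℚ-Solver
open import Data.Sum.Base using (inj₁; inj₂)
open import Data.Vec.Base using ([]; _++_; map; lookup)
import Data.Vec.Properties as Vec
import Data.Vec.Relation.Unary.All as VAll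
import Data.Vec.Relation.Unary.All.Properties as VAll
open import Function.Base using (_∘_; id)
open import Function.Bundles using (_⇔_; mk⇔)
open import Relation.Binary.PropositionalEquality
open import Relation.Nullary using (¬_; yes; no; does; contradiction)
open import Relation.Nullary.Decidable using (does-⇔)
open import Relation.Unary using (Decidable)

-- Counting natural numbers with a periodic property.

count : {P : ℕ → Set} → Decidable P → ℕ → ℕ
count P? zero    = 0
count P? (suc n) = (if does (P? 0) then suc else id) (count (P? ∘ suc) n)

count-⇔ : ∀ {P Q : ℕ → Set} (P? : Decidable P) (Q? : Decidable Q) →
          (∀ k → P k ⇔ Q k) → ∀ n → count P? n ≡ count Q? n
count-⇔ P? Q? P⇔Q zero    = refl
count-⇔ P? Q? P⇔Q (suc n) = cong₂ (λ b → if b then suc else id)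
  (does-⇔ (P⇔Q 0) (P? 0) (Q? 0)) (count-⇔ (P? ∘ suc) (Q? ∘ suc) (P⇔Q ∘ suc) n)

count-+ : ∀ {P : ℕ → Set} (P? : Decidable P) m n →
          count P? (m + n) ≡ count P? m + count (P? ∘ _+_ m) n
count-+ P? zero    n = refl
count-+ P? (suc m) n with does (P? 0)
... | true  = cong suc (count-+ (P? ∘ suc) m n)
... | false = count-+ (P? ∘ suc) m n

Periodic : ℕ → (ℕ → Set) → Set
Periodic m P = ∀ k → P (m + k) ⇔ P k

-- One period is split off at a time; by periodicity the predicate shifted by `m` has the same count
-- as the original one.
count-periodic : ∀ {P : ℕ → Set} (P? : Decidable P) {m} → Periodic m P →
                 ∀ c → count P? (c * m) ≡ c * count P? m
count-periodic P? {m} period zero    = refl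
count-periodic P? {m} period (suc c) = begin
  count P? (m + c * m)                           ≡⟨ count-+ P? m (c * m) ⟩
  count P? m + count (P? ∘ _+_ m) (c * m)        ≡⟨ cong (_+_ (count P? m)) (count-⇔ (P? ∘ _+_ m) P? period (c * m)) ⟩
  count P? m + count P? (c * m)                  ≡⟨ cong (_+_ (count P? m)) (count-periodic P? period c) ⟩
  count P? m + c * count P? m                    ∎
  where open ≡-Reasoning

-- Links `card`, which filters `allFin`, to `count`. The function `f` is arbitrary so that the
-- induction can pass to `f ∘ Fin.suc` while `count` shifts its predicate.
length-filter-tabulate : ∀ {A : Set} {P : A → Set} {Q : ℕ → Set}
  (P? : Decidable P) (Q? : Decidable Q) {n} (f : Fin n → A) →
  (∀ i → P (f i) ⇔ Q (toℕ i)) → length (filter P? (tabulate f)) ≡ count Q? n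
length-filter-tabulate P? Q? {zero}  f P⇔Q = refl
length-filter-tabulate P? Q? {suc n} f P⇔Q
  -- The third term equates the two booleans, which rules out the mixed cases.
  with does (P? (f Fin.zero)) | does (Q? 0) | does-⇔ (P⇔Q Fin.zero) (P? (f Fin.zero)) (Q? 0)
... | true  | true  | _ = cong suc (length-filter-tabulate P? (Q? ∘ suc) (f ∘ Fin.suc) (P⇔Q ∘ Fin.suc))
... | false | false | _ = length-filter-tabulate P? (Q? ∘ suc) (f ∘ Fin.suc) (P⇔Q ∘ Fin.suc)

card≡count : ∀ {n} {P : Fin n → Set} {Q : ℕ → Set} (P? : Decidable P) (Q? : Decidable Q) →
             (∀ i → P i ⇔ Q (toℕ i)) → card P? ≡ count Q? n
card≡count P? Q? = length-filter-tabulate P? Q? id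

-- The square-free part and coprimality.

product-∣ : ∀ {n ps} → All Prime ps → Unique ps → All (_∣ n) ps → product ps ∣ n
product-∣ {n} []                 []              []                        = 1∣ n
product-∣ {n} {p ∷ ps} (pr ∷ prs) (p∉ps ∷ unique) (divides q refl ∷ ps∣n) =
  -- By induction `product ps` divides `q * p`; being coprime to `p`, it divides `q`.
  subst (_∣ q * p) (ℕ.*-comm (product ps) p)
    (*-monoˡ-∣ p (Coprime.coprime-divisor coprime
      (subst (product ps ∣_) (ℕ.*-comm q p) (product-∣ prs unique ps∣n))))
  where
  coprime : Coprime (product ps) p
  -- A divisor of the prime `p` is `1` or `p`; in the second case `p` would occur in `ps`, against
  -- uniqueness.
  coprime (d∣Π , d∣p) with prime⇒irreducible pr d∣p
  ... | inj₁ d≡1  = d≡1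
  ... | inj₂ refl = contradiction refl
        (All.lookup p∉ps (factorisationHasAllPrimeFactors pr d∣Π prs))

primeDivisors-all : ∀ n → All (λ p → Prime p × p ∣ n) (primeDivisors n)
primeDivisors-all n = All.all-filter (isPrimeDivisor? n) (downFrom (suc n))

squarefreePart-∣ : ∀ n → squarefreePart n ∣ n
squarefreePart-∣ n = product-∣ (All.map proj₁ (primeDivisors-all n))
  (Unique.filter⁺ (isPrimeDivisor? n) (Unique.downFrom⁺ (suc n)))
  (All.map proj₂ (primeDivisors-all n))

no-prime-divisor⇒≡1 : ∀ n .{{_ : NonZero n}} → (∀ {p} → Prime p → ¬ p ∣ n) → n ≡ 1
no-prime-divisor⇒≡1 n none with factorise n
... | record { factors = [] ; isFactorisation = n≡1 } = n≡1
... | record { factors = p ∷ ps ; isFactorisation = n≡ ; factorsPrime = pr ∷ _ } =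
  contradiction (subst (p ∣_) (sym n≡) (m∣m*n (product ps))) (none pr)

-- A common divisor of `k` and `n` other than `1` would have a prime factor, and every prime
-- dividing `n` also divides its square-free part.
coprime-squarefreePart : ∀ k n .{{_ : NonZero n}} → Coprime k n ⇔ Coprime k (squarefreePart n)
coprime-squarefreePart k n = mk⇔ to from
  where
  to : Coprime k n → Coprime k (squarefreePart n)
  to k⊥n (d∣k , d∣n₀) = k⊥n (d∣k , ∣-trans d∣n₀ (squarefreePart-∣ n))

  from : Coprime k (squarefreePart n) → Coprime k n
  from k⊥n₀ {d} (d∣k , d∣n) = no-prime-divisor⇒≡1 d no-prime
    where
    instance
      d≢0 : NonZero d
      d≢0 = ℕ.≢-nonZero λ { refl → ℕ.≢-nonZero⁻¹ n (0∣⇒≡0 d∣n) }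
    no-prime : ∀ {p} → Prime p → ¬ p ∣ d
    no-prime pr p∣d = ¬prime[1] (subst Prime (k⊥n₀ (∣-trans p∣d d∣k , p∣n₀)) pr)
      where
      p∣n = ∣-trans p∣d d∣n
      p∣n₀ = ∈⇒∣product (∈-filter⁺ (isPrimeDivisor? n) (∈-downFrom⁺ (s≤s (∣⇒≤ p∣n))) (pr , p∣n))

-- Periodicity of gcd conditions, and degrees as counts.

≡-⇔ : ∀ {A : Set} {x y z : A} → x ≡ y → (x ≡ z) ⇔ (y ≡ z)
≡-⇔ x≡y = mk⇔ (trans (sym x≡y)) (trans x≡y)

gcd[m+k,m]≡gcd[k,m] : ∀ m k → gcd (m + k) m ≡ gcd k m
gcd[m+k,m]≡gcd[k,m] m k = ∣-antisym
  (gcd-greatest (∣m+n∣m⇒∣n (gcd[m,n]∣m (m + k) m) (gcd[m,n]∣n (m + k) m)) (gcd[m,n]∣n (m + k) m))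
  (gcd-greatest (∣m∣n⇒∣m+n (gcd[m,n]∣n k m) (gcd[m,n]∣m k m)) (gcd[m,n]∣n k m))

coprime-periodic : ∀ {d m} → d ∣ m → Periodic m (λ k → Coprime k d)
coprime-periodic {d} {m} d∣m k = mk⇔ to from
  where
  to : Coprime (m + k) d → Coprime k d
  to m+k⊥d (e∣k , e∣d) = m+k⊥d (∣m∣n⇒∣m+n (∣-trans e∣d d∣m) e∣k , e∣d)

  from : Coprime k d → Coprime (m + k) d
  from k⊥d (e∣m+k , e∣d) = k⊥d (∣m+n∣m⇒∣n e∣m+k (∣-trans e∣d d∣m) , e∣d)

-- The vertex `d mod n` is `d`, or `0` when `d = n`; either way its common divisors with `n` are the
-- divisors of `d`, so `gcd₃ a b` is `1` exactly when `b` is coprime to `d`. For `d = 1` the count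
-- would be too large by one, as it would include the vertex itself.
degree≡count : ∀ {n} .{{_ : NonZero n}} {d} → d ∣ n → d ≢ 1 →
               degree (d mod n) ≡ count (λ k → coprime? k d) n
degree≡count {n} {d} d∣n d≢1 =
  card≡count (adjacent? a) (λ k → coprime? k d) λ b → mk⇔ (adjacent⇒coprime b) (coprime⇒adjacent b)
  where
  a : Fin n
  a = d mod n
  toℕ-a : toℕ a ≡ d % n
  toℕ-a = Fin.toℕ-fromℕ< _
  ∣d⇒∣a : ∀ {e} → e ∣ d → e ∣ toℕ a
  ∣d⇒∣a e∣d = subst (_ ∣_) (sym toℕ-a) (%-presˡ-∣ e∣d (∣-trans e∣d d∣n))
  ∣a∧∣n⇒∣d : ∀ {e} → e ∣ toℕ a → e ∣ n → e ∣ d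
  ∣a∧∣n⇒∣d e∣a e∣n = ∣n∣m%n⇒∣m e∣n (subst (_ ∣_) toℕ-a e∣a)

  adjacent⇒coprime : ∀ b → Adjacent a b → Coprime (toℕ b) d
  adjacent⇒coprime b (_ , gen) {e} (e∣b , e∣d) =
    ∣1⇒≡1 (subst (e ∣_) (Generate⇒gcd≡1 a b gen)
      (gcd-greatest (gcd-greatest (∣d⇒∣a e∣d) e∣b) (∣-trans e∣d d∣n)))

  coprime⇒adjacent : ∀ b → Coprime (toℕ b) d → Adjacent a b
  coprime⇒adjacent b b⊥d =
    -- If `b` were `a`, then `d` would divide `b`, and coprimality would force `d` to be `1`.
    (λ { refl → d≢1 (b⊥d (∣d⇒∣a ∣-refl , ∣-refl)) }) ,
    gcd≡1⇒Generate a b (b⊥d (∣-trans gcd₃∣g (gcd[m,n]∣n (toℕ a) (toℕ b)) ,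
                             ∣a∧∣n⇒∣d (∣-trans gcd₃∣g (gcd[m,n]∣m (toℕ a) (toℕ b))) (gcd[m,n]∣n g n)))
    where
    g : ℕ
    g = gcd (toℕ a) (toℕ b)
    gcd₃∣g : gcd₃ a b ∣ g
    gcd₃∣g = gcd[m,n]∣m g n

-- The ordered list of divisors.

orderedDivisors-∣ : ∀ ps i → lookup (orderedDivisors ps) i ∣ product ps
orderedDivisors-∣ ps i = VAll.lookup⁺ (all ps) i
  where
  all : ∀ ps → VAll.All (_∣ product ps) (orderedDivisors ps)
  all []       = ∣-refl VAll.∷ VAll.[]
  all (p ∷ ps) = VAll.++⁺ (VAll.map (∣n⇒∣m*n p) (all ps))
    (VAll.++⁺ (VAll.map⁺ {P = _∣ p * product ps} (VAll.map (λ {d} d∣ → subst (d * p ∣_) (ℕ.*-comm (product ps) p) (*-monoˡ-∣ p d∣)) (all ps))) VAll.[])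

-- Entries of the second half are multiples of the prime `p`, so `1` can only lie in the first half,
-- where induction applies. This supplies `d ≢ 1` for the degrees on the diagonal.
orderedDivisors≡1⇒first : ∀ ps → All Prime ps → ∀ i → lookup (orderedDivisors ps) i ≡ 1 → toℕ i ≡ 0
orderedDivisors≡1⇒first []       []         Fin.zero _ = refl
orderedDivisors≡1⇒first (p ∷ ps) (pr ∷ prs) i d≡1
  with Fin.splitAt (2 ^ length ps) i | Fin.join-splitAt (2 ^ length ps) (2 ^ length ps + 0) i
... | inj₁ j | refl = trans (Fin.toℕ-↑ˡ j _)
  (orderedDivisors≡1⇒first ps prs j (trans (sym (Vec.lookup-++ˡ (orderedDivisors ps) _ j)) d≡1))
... | inj₂ j | refl = contradiction
  (trans (sym (Vec.lookup-++ʳ (orderedDivisors ps) (map (_* p) (orderedDivisors ps) ++ []) j)) d≡1)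
  (VAll.lookup⁺ (VAll.++⁺ (VAll.map⁺ {P = _≢ 1} (VAll.universal d*p≢1 (orderedDivisors ps))) VAll.[]) j)
  where
  d*p≢1 : ∀ d → d * p ≢ 1
  d*p≢1 d dp≡1 = ¬prime[1] (subst Prime (ℕ.m*n≡1⇒n≡1 d p dp≡1) pr)

-- The lists are variables so that their equation can be matched with `refl`, which makes the cast
-- an identity.
lookup-orderedDivisors-cast : ∀ {ps qs} → ps ≡ qs → .(eq : 2 ^ length qs ≡ 2 ^ length ps) → ∀ i →
  lookup (orderedDivisors ps) (Fin.cast eq i) ≡ lookup (orderedDivisors qs) i
lookup-orderedDivisors-cast {ps} refl eq i = cong (lookup (orderedDivisors ps)) (Fin.cast-is-id eq i)

-- Scaling real numbers and square roots.

≈-respʳ : ∀ {x y z} → (∀ k → seq y k ≃ seq z k) → x ≈ y → x ≈ z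
≈-respʳ {x} {y} {z} y≃z x≈y ε with N , h ← x≈y ε = N , λ k N≤k →
  ℚ.≤-trans (ℚ.≤-reflexive (ℚ.∣-∣-cong (ℚ.+-congʳ (seq x k) (ℚ.-‿cong (ℚ.≃-sym (y≃z k)))))) (h k N≤k)

≃⇒≈ : ∀ {x y} → (∀ k → seq x k ≃ seq y k) → x ≈ y
≃⇒≈ {x} {y} x≃y ε = 0 , λ k _ →
  ℚ.≤-trans (ℚ.≤-reflexive (ℚ.∣-∣-cong (ℚ.p≃q⇒p-q≃0 (seq x k) (seq y k) (x≃y k))))
            (ℚ.<⇒≤ (ℚ.positive⁻¹ ε))

neg-cong-· : ∀ {x} q y → x ≈ fromℚ q · y → - x ≈ fromℚ q · - y
neg-cong-· {x} q y x≈qy ε with N , h ← x≈qy ε = N , λ k N≤k →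
  ℚ.≤-trans (ℚ.≤-reflexive (ℚ.≃-trans (ℚ.∣-∣-cong (neg-diff (seq x k) q (seq y k)))
                                      (ℚ.∣-p∣≃∣p∣ (seq x k ℚ.- q ℚ.* seq y k))))
            (h k N≤k)
  where
  neg-diff : ∀ a b c → ℚ.- a ℚ.- b ℚ.* ℚ.- c ≃ ℚ.- (a ℚ.- b ℚ.* c)
  neg-diff = solve 3 (λ a b c → :- a :- b :* (:- c) := :- (a :- b :* c)) ℚ.≃-refl
    where open ℚ-Solver.+-*-Solver

fromℕ-scale : ∀ c m → fromℕ (c * m) ≈ fromℕ c · fromℕ m
fromℕ-scale c m = ≃⇒≈ {fromℕ (c * m)} {fromℕ c · fromℕ m} λ _ → *≡* (cong (ℤ._* + 1) (ℤ.pos-* c m))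

-- The real root of `m * K²` lies between `t` and `suc t`, so `c` times it lies between `c * t` and
-- `c * suc t`; `s` is the floor of this multiple. The error `r` is thus bounded independently of
-- `k`.
√-num-scale : ∀ c m k → ∃[ r ] r ≤ c × √-num (c * c * m) k ≡ c * √-num m k + r
√-num-scale c m k = s ∸ c * t ,
  ℕ.m≤n+o⇒m∸n≤o s (c * t) (ℕ.≤-trans s≤ (ℕ.≤-reflexive (trans (ℕ.*-suc c t) (ℕ.+-comm c (c * t))))) ,
  sym (ℕ.m+[n∸m]≡n ct≤s)
  where
  K² = suc k * suc k
  s = √-num (c * c * m) k
  t = √-num m k
  open ℕ.≤-Reasoning
  ct≤s : c * t ≤ s
  -- Otherwise `suc s` would be at most `c * t`, whose square is at most `c * c * m * K²`, and `s`
  -- would not be the floor of the root.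
  ct≤s = ℕ.≮⇒≥ λ s<ct → ℕ.<⇒≱ (⌊√⌋-upper (c * c * m * K²)) (begin
    suc s * suc s      ≤⟨ ℕ.*-mono-≤ s<ct s<ct ⟩
    c * t * (c * t)    ≡⟨ ℕ.[m*n]*[o*p]≡[m*o]*[n*p] c t c t ⟩
    c * c * (t * t)    ≤⟨ ℕ.*-monoʳ-≤ (c * c) (⌊√⌋-lower (m * K²)) ⟩
    c * c * (m * K²)   ≡⟨ ℕ.*-assoc (c * c) m K² ⟨
    c * c * m * K²     ∎)
  s≤ : s ≤ c * suc t
  s≤ = ℕ.≮⇒≥ λ c[1+t]<s → ℕ.<⇒≱ (ℕ.*-mono-< c[1+t]<s c[1+t]<s) (begin
    s * s                      ≤⟨ ⌊√⌋-lower (c * c * m * K²) ⟩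
    c * c * m * K²             ≡⟨ ℕ.*-assoc (c * c) m K² ⟩
    c * c * (m * K²)           ≤⟨ ℕ.*-monoʳ-≤ (c * c) (ℕ.<⇒≤ (⌊√⌋-upper (m * K²))) ⟩
    c * c * (suc t * suc t)    ≡⟨ ℕ.[m*n]*[o*p]≡[m*o]*[n*p] c c (suc t) (suc t) ⟩
    c * suc t * (c * suc t)    ∎)

√-scale : ∀ c m → √ (c * c * m) ≈ fromℕ c · √ m
-- The `k`-th approximations differ by `r / (k + 1)` with `r ≤ c`. This is at most `ε`, that is
-- `(p + 1) / (q + 1)`, once `k` reaches `c * suc q`.
√-scale c m ε@(mkℚᵘ (+ suc p) q) = c * suc q , λ k N≤k → bound k N≤k (√-num-scale c m k)
  where
  difference : ∀ k t r → mkℚᵘ (+ (c * t + r)) k ℚ.- mkℚᵘ (+ c) 0 ℚ.* mkℚᵘ (+ t) k ≃ mkℚᵘ (+ r) k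
  difference k t r = begin-equality
    mkℚᵘ (+ (c * t + r)) k ℚ.- mkℚᵘ (+ c) 0 ℚ.* mkℚᵘ (+ t) k
      ≃⟨ ℚ.+-cong (split (c * t) r) (ℚ.-‿cong product-≃) ⟩
    (mkℚᵘ (+ (c * t)) k ℚ.+ mkℚᵘ (+ r) k) ℚ.- mkℚᵘ (+ (c * t)) k
      ≃⟨ cancel (mkℚᵘ (+ (c * t)) k) (mkℚᵘ (+ r) k) ⟩
    mkℚᵘ (+ r) k ∎
    where
    open ℚ.≤-Reasoning
    common-denominator : ∀ A B K → (A ℤ.+ B) ℤ.* (K ℤ.* K) ≡ (A ℤ.* K ℤ.+ B ℤ.* K) ℤ.* K
    common-denominator = ℤ-Solver.solve-∀
    split : ∀ a b → mkℚᵘ (+ (a + b)) k ≃ mkℚᵘ (+ a) k ℚ.+ mkℚᵘ (+ b) k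
    split a b = *≡* (common-denominator (+ a) (+ b) (+ suc k))
    product-≃ : mkℚᵘ (+ c) 0 ℚ.* mkℚᵘ (+ t) k ≃ mkℚᵘ (+ (c * t)) k
    product-≃ = *≡* (cong₂ ℤ._*_ (sym (ℤ.pos-* c t)) (cong +_ (sym (ℕ.*-identityˡ (suc k)))))
    cancel : ∀ a b → (a ℚ.+ b) ℚ.- a ≃ b
    cancel = solve 2 (λ a b → (a :+ b) :- a := b) ℚ.≃-refl
      where open ℚ-Solver.+-*-Solver
  bound : ∀ k → c * suc q ≤ k → ∃[ r ] r ≤ c × √-num (c * c * m) k ≡ c * √-num m k + r →
          ℚ.∣ √-approx (c * c * m) k ℚ.- mkℚᵘ (+ c) 0 ℚ.* √-approx m k ∣ ℚ.≤ ε
  bound k N≤k (r , r≤c , s≡) rewrite s≡ = ℚ.≤-trans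
    (ℚ.≤-reflexive (ℚ.∣-∣-cong (difference k (√-num m k) r)))
    (*≤* (subst₂ ℤ._≤_ (ℤ.pos-* r (suc q)) (ℤ.pos-* (suc p) (suc k)) (ℤ.+≤+ (begin
      r * suc q        ≤⟨ ℕ.*-monoˡ-≤ (suc q) r≤c ⟩
      c * suc q        ≤⟨ N≤k ⟩
      k                ≤⟨ ℕ.n≤1+n k ⟩
      suc k            ≤⟨ ℕ.m≤n*m (suc k) (suc p) ⟩
      suc p * suc k    ∎))))
    where open ℕ.≤-Reasoning

·-congˡ : ∀ {p q x} y → p ≃ q → x ≈ fromℚ p · y → x ≈ fromℚ q · y
·-congˡ {p} {q} {x} y p≃q = ≈-respʳ {x} {fromℚ p · y} {fromℚ q · y} (λ k → ℚ.*-congʳ {seq y k} p≃q)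

-- Trades the unnormalised fraction `n / n₀` for the integer factor `c` by which the counts scale.
/-≃ : ∀ {n m c} .{{_ : NonZero m}} → n ≡ c * m → + c / 1 ≃ + n / m
/-≃ {m = suc m} {c} refl = *≡* (trans (sym (ℤ.pos-* c (suc m))) (sym (ℤ.*-identityʳ (+ (c * suc m)))))

-- Comparing the entries of the two matrices.

module _ {n n₀ c : ℕ} .{{_ : NonZero n}} .{{_ : NonZero n₀}} (n≡cn₀ : n ≡ c * n₀)
         (n₀-squarefreePart : squarefreePart n ≡ n₀)
         (same-primes : primeDivisors n₀ ≡ primeDivisors n) where

  private
    q = + n / n₀

    q≃ : + c / 1 ≃ q
    q≃ = /-≃ n≡cn₀

    n₀∣n : n₀ ∣ n
    n₀∣n = divides c n≡cn₀

    ω-eq : 2 ^ ω n₀ ≡ 2 ^ ω n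
    ω-eq = cong (λ ps → 2 ^ length ps) same-primes

    index₀ : Fin (2 ^ ω n) → Fin (2 ^ ω n₀)
    index₀ = Fin.cast (sym ω-eq)

    toℕ-index₀ : ∀ i → toℕ (index₀ i) ≡ toℕ i
    toℕ-index₀ = Fin.toℕ-cast _

  divisor-index₀ : ∀ i → divisor n₀ (index₀ i) ≡ divisor n i
  divisor-index₀ = lookup-orderedDivisors-cast same-primes (sym ω-eq)

  count-scale : ∀ {P : ℕ → Set} (P? : Decidable P) → Periodic n₀ P → count P? n ≡ c * count P? n₀
  count-scale {P} P? period = trans (cong (count P?) n≡cn₀) (count-periodic P? period c)

  φ-scale : φ n ≡ c * φ n₀
  φ-scale = begin
    φ n                  ≡⟨ card≡count {n} {λ k → Coprime (suc (toℕ k)) n} {P} (λ k → coprime? (suc (toℕ k)) n) P? (λ k →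
                                subst (λ m → Coprime (suc (toℕ k)) n ⇔ Coprime (suc (toℕ k)) m) n₀-squarefreePart
                                  (coprime-squarefreePart (suc (toℕ k)) n)) ⟩
    count P? n           ≡⟨ count-scale {P} P? period ⟩
    c * count P? n₀      ≡⟨ cong (c *_) (card≡count {n₀} {λ k → P (toℕ k)} {P} (λ k → coprime? (suc (toℕ k)) n₀) P? (λ k → mk⇔ id id)) ⟨
    c * φ n₀             ∎
    where
    open ≡-Reasoning
    P : ℕ → Set
    -- The shift by one reflects that `φ` counts among `1, …, n`.
    P k = Coprime (suc k) n₀
    P? : Decidable P
    P? k = coprime? (suc k) n₀
    period : Periodic n₀ P
    period k = subst (λ j → Coprime j n₀ ⇔ P k) (ℕ.+-suc n₀ k) (coprime-periodic ∣-refl (suc k))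

  -- The classes for both moduli are given by the gcd with the same number, since `n₀` is its own
  -- square-free part.
  class-scale : ∀ d → ∣class∣ n d ≡ c * ∣class∣ n₀ d
  class-scale d = begin
    ∣class∣ n d          ≡⟨ card≡count {n} {_∈[ d ]} {P} (_∈[ d ]?) P? (λ a → ≡-⇔ (cong (gcd (toℕ a)) n₀-squarefreePart)) ⟩
    count P? n           ≡⟨ count-scale P? (λ k → ≡-⇔ (gcd[m+k,m]≡gcd[k,m] n₀ k)) ⟩
    c * count P? n₀      ≡⟨ cong (c *_) (card≡count {n₀} {_∈[ d ]} {P} (_∈[ d ]?) P? (λ a → ≡-⇔ (cong (gcd (toℕ a)) (trans (cong product same-primes) n₀-squarefreePart)))) ⟨
    c * ∣class∣ n₀ d     ∎
    where
    open ≡-Reasoning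
    P : ℕ → Set
    P k = gcd k n₀ ≡ d
    P? : Decidable P
    P? k = gcd k n₀ ℕ.≟ d

  classSize-scale : ∀ i → classSize n i ≡ c * classSize n₀ (index₀ i)
  classSize-scale i = trans (class-scale (divisor n i))
    (cong (λ d → c * ∣class∣ n₀ d) (sym (divisor-index₀ i)))

  deg-scale : ∀ {d} → d ∣ n₀ → d ≢ 1 → deg n d ≡ c * deg n₀ d
  deg-scale {d} d∣n₀ d≢1 = begin
    deg n d              ≡⟨ degree≡count {n} {d} (∣-trans d∣n₀ n₀∣n) d≢1 ⟩
    count P? n           ≡⟨ count-scale P? (coprime-periodic d∣n₀) ⟩
    c * count P? n₀      ≡⟨ cong (c *_) (degree≡count {n₀} {d} d∣n₀ d≢1) ⟨
    c * deg n₀ d         ∎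
    where
    open ≡-Reasoning
    P? : Decidable (λ k → Coprime k d)
    P? k = coprime? k d

  -- `index₀` preserves positions and the two matrices have equal size, so the tests for the first
  -- and last index agree; the mixed cases are contradictory.
  diagonal-scale : ∀ i → diagonal n i ≡ c * diagonal n₀ (index₀ i)
  diagonal-scale i with first? n i | first? n₀ (index₀ i) | last? n i | last? n₀ (index₀ i)
  ... | yes _   | yes _   | _     | _     =
    trans (cong₂ _∸_ n≡cn₀ φ-scale) (sym (ℕ.*-distribˡ-∸ c n₀ (φ n₀)))
  ... | yes i≡0 | no i≢0  | _     | _     = contradiction (trans (toℕ-index₀ i) i≡0) i≢0
  ... | no i≢0  | yes i≡0 | _     | _     = contradiction (trans (sym (toℕ-index₀ i)) i≡0) i≢0
  ... | no _    | no _    | yes _ | yes _ = φ-scale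
  ... | no _    | no _    | yes l | no ¬l = contradiction
    (trans (cong suc (toℕ-index₀ i)) (trans l (sym ω-eq))) ¬l
  ... | no _    | no _    | no ¬l | yes l = contradiction
    (trans (cong suc (sym (toℕ-index₀ i))) (trans l ω-eq)) ¬l
  ... | no i≢0  | no _    | no _  | no _  = trans
    (deg-scale (subst (divisor n i ∣_) n₀-squarefreePart (orderedDivisors-∣ (primeDivisors n) i))
      (i≢0 ∘ orderedDivisors≡1⇒first (primeDivisors n) (All.map proj₁ (primeDivisors-all n)) i))
    (cong (λ d → c * deg n₀ d) (sym (divisor-index₀ i)))

  √-*-scale : ∀ {a b a₀ b₀} → a ≡ c * a₀ → b ≡ c * b₀ → √ (a * b) ≈ fromℚ q · √ (a₀ * b₀)
  √-*-scale {a} {b} {a₀} {b₀} a≡ b≡ = ·-congˡ {x = √ (a * b)} (√ (a₀ * b₀)) q≃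
    (subst (λ m → √ m ≈ fromℕ c · √ (a₀ * b₀))
      -- Each factor under the root contributes one `c`, giving the square `c * c` that `√-scale`
      -- extracts.
      (trans (ℕ.[m*n]*[o*p]≡[m*o]*[n*p] c c a₀ b₀) (sym (cong₂ _*_ a≡ b≡)))
      (√-scale c (a₀ * b₀)))

  fromℕ-*-scale : ∀ {a a₀} → a ≡ c * a₀ → fromℕ a ≈ fromℚ q · fromℕ a₀
  fromℕ-*-scale {a} {a₀} refl = ·-congˡ {x = fromℕ a} (fromℕ a₀) q≃ (fromℕ-scale c a₀)

  ρ-scale : ∀ i j → ρ n i j ≈ fromℚ q · ρ n₀ (index₀ i) (index₀ j)
  ρ-scale i j
    with first? n i | first? n₀ (index₀ i) | first? n j | first? n₀ (index₀ j)
       | gcd (divisor n i) (divisor n j) ℕ.≟ 1 | gcd (divisor n₀ (index₀ i)) (divisor n₀ (index₀ j)) ℕ.≟ 1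
  ... | yes i≡0 | no i≢0  | _       | _       | _     | _     = contradiction (trans (toℕ-index₀ i) i≡0) i≢0
  ... | no i≢0  | yes i≡0 | _       | _       | _     | _     = contradiction (trans (sym (toℕ-index₀ i)) i≡0) i≢0
  ... | yes _   | yes _   | _       | _       | _     | _     = √-*-scale φ-scale (classSize-scale j)
  ... | no _    | no _    | yes j≡0 | no j≢0  | _     | _     = contradiction (trans (toℕ-index₀ j) j≡0) j≢0
  ... | no _    | no _    | no j≢0  | yes j≡0 | _     | _     = contradiction (trans (sym (toℕ-index₀ j)) j≡0) j≢0
  ... | no _    | no _    | yes _   | yes _   | _     | _     = √-*-scale φ-scale (classSize-scale i)
  ... | no _    | no _    | no _    | no _    | yes _ | yes _ = √-*-scale (classSize-scale i) (classSize-scale j)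
  ... | no _    | no _    | no _    | no _    | no _  | no _  = fromℕ-*-scale (sym (ℕ.*-zeroʳ c))
  ... | no _    | no _    | no _    | no _    | yes g≡1 | no g≢1 =
    contradiction (trans (cong₂ gcd (divisor-index₀ i) (divisor-index₀ j)) g≡1) g≢1
  ... | no _    | no _    | no _    | no _    | no g≢1 | yes g≡1 =
    contradiction (trans (sym (cong₂ gcd (divisor-index₀ i) (divisor-index₀ j))) g≡1) g≢1

  L_Q-scale : ∀ i j → L_Q n i j ≈ fromℚ q · L_Q n₀ (index₀ i) (index₀ j)
  L_Q-scale i j with i Fin.≟ j | index₀ i Fin.≟ index₀ j
  ... | yes _    | yes _  = fromℕ-*-scale (diagonal-scale i)
  ... | no _     | no _   = neg-cong-· {x = ρ n i j} q (ρ n₀ (index₀ i) (index₀ j)) (ρ-scale i j)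
  ... | yes i≡j  | no i≢j = contradiction (cong index₀ i≡j) i≢j
  ... | no i≢j   | yes eq = contradiction
    (Fin.toℕ-injective (trans (sym (toℕ-index₀ i)) (trans (cong toℕ eq) (toℕ-index₀ j)))) i≢j

theorem5p0p6 : (n : ℕ) .{{_ : NonZero n}} → 2 ≤ n →
    let instance _ = squarefreePart-nonZero n
    in L_Q n ≈ᴹ (+ n / squarefreePart n)
    ·ᴹ castᴹ (cong (2 ^_) (ω-squarefreePart n)) (L_Q (squarefreePart n))
-- The cast in the statement agrees with `index₀` because the size equation is an irrelevant
-- argument.
theorem5p0p6 n _ = L_Q-scale {c = quotient (squarefreePart-∣ n)} (_∣_.equality (squarefreePart-∣ n)) refl
  (primeDivisors-squarefreePart n)
  where instance _ = squarefreePart-nonZero n
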